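{- Let $k\ge 2$ and $\alpha\in[0,1)$ be such that $b=\frac{k-1}{1-\alpha}$ is an integer, and let $n$ be a positive integer divisible by $b$; put $t=\alpha n$ (an integer). Then \[ S(n,t,k)\ \ge\ \binom{b}{\alpha b}^{n/b}. \]
   Context: A $k$-CNF formula is a conjunction of clauses (disjunctions of literals) each of width at most $k$. $\mathrm{sat}_t(F)$ is the set of satisfying assignments of $F$ of Hamming weight exactly $t$. $F$ is $t$-admissible if it has no satisfying assignment of Hamming weight less than $t$. $S(n,t,k)$ is the maximum of $|\mathrm{sat}_t(F)|$ over all $t$-admissible $k$-CNF formulas $F$ on $n$ variables. -}

module Defs where

open import Data.Bool using (Bool; true; false)
import Data.Bool.Properties as Bool
open import Data.Fin using (Fin)
import Data.Fin.Properties as Fin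
open import Data.Fin.Subset using (∣_∣)
open import Data.Fin.Subset.Properties using (anySubset?)
open import Data.Integer using (+_)
open import Data.List using (List; []; _∷_; _++_; length; map; filter; allFin;
  cartesianProduct; cartesianProductWith)
open import Data.List.Extrema.Nat using (max; max≤v⁺; xs≤max; argmax-sel)
open import Data.List.Membership.Propositional using (_∈_)
import Data.List.Membership.DecPropositional as DecMembership
open import Data.List.Membership.Propositional.Properties
open import Data.List.Properties using (≡-dec; filter-≐; filter-none)
open import Data.List.Relation.Unary.All as All using (All; []; _∷_; all?)
open import Data.List.Relation.Unary.AllPairs using ([]; _∷_)
open import Data.List.Relation.Unary.Any as Any using (Any; here; there; any?)
open import Data.List.Relation.Unary.Unique.Propositional using (Unique)
import Data.List.Relation.Unary.Unique.Propositional.Properties as Unique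
open import Data.Nat using (ℕ; zero; suc; _≤_; _<_; z≤n; s≤s; _≟_; _<?_)
open import Data.Product using (∃; _×_; _,_; proj₁; proj₂)
import Data.Product.Properties as Product
open import Data.Rational as ℚ using (ℚ; 0ℚ; 1ℚ)
import Data.Rational.Properties as ℚ
open import Data.Sum using (inj₁; inj₂)
open import Data.Vec using (Vec; []; _∷_; lookup)
open import Data.Vec.Properties using (∷-injectiveʳ)
open import Function using (id; _∘_; _⇔_; mk⇔)
open import Relation.Binary.PropositionalEquality using (_≡_; refl; sym; trans; cong; subst)
open import Relation.Nullary using (¬_; Dec; yes; no)
open import Relation.Nullary.Decidable using (map′; _×-dec_; ¬?)

-- The literal (i , true) is the variable xᵢ, and (i , false) is its negation.
Literal : ℕ → Set
Literal n = Fin n × Bool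

Clause : ℕ → Set
Clause n = List (Literal n)

CNF : ℕ → Set
CNF n = List (Clause n)

IsKCNF : ∀ {n} → ℕ → CNF n → Set
IsKCNF k F = All (λ C → length C ≤ k) F

Assignment : ℕ → Set
Assignment n = Vec Bool n

weight : ∀ {n} → Assignment n → ℕ
weight a = ∣ a ∣

module _ {n : ℕ} where

  infix 4 _⊨ˡ_ _⊨ᶜ_ _⊨_ _⊨?_

  _⊨ˡ_ : Assignment n → Literal n → Set
  a ⊨ˡ (i , s) = lookup a i ≡ s

  _⊨ᶜ_ : Assignment n → Clause n → Set
  a ⊨ᶜ C = Any (a ⊨ˡ_) C

  _⊨_ : Assignment n → CNF n → Set
  a ⊨ F = All (a ⊨ᶜ_) F

  _⊨?_ : (a : Assignment n) (F : CNF n) → Dec (a ⊨ F)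
  a ⊨? F = all? (any? (λ (i , s) → lookup a i Bool.≟ s)) F

assignments : ∀ n → List (Assignment n)
assignments zero    = [] ∷ []
assignments (suc n) = map (true ∷_) (assignments n) ++ map (false ∷_) (assignments n)

∈-assignments : ∀ {n} (a : Assignment n) → a ∈ assignments n
∈-assignments []          = here refl
∈-assignments (true  ∷ a) = ∈-++⁺ˡ (∈-map⁺ _ (∈-assignments a))
∈-assignments (false ∷ a) = ∈-++⁺ʳ _ (∈-map⁺ _ (∈-assignments a))

assignments-unique : ∀ n → Unique (assignments n)
assignments-unique zero    = [] ∷ []
assignments-unique (suc n) = Unique.++⁺
  (Unique.map⁺ ∷-injectiveʳ (assignments-unique n))
  (Unique.map⁺ ∷-injectiveʳ (assignments-unique n))
  λ (p , q) → disjoint (∈-map⁻ _ p) (∈-map⁻ _ q)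
  where
  disjoint : ∀ {v : Assignment (suc n)} →
    ∃ (λ a → a ∈ assignments n × v ≡ true ∷ a) →
    ¬ ∃ (λ a → a ∈ assignments n × v ≡ false ∷ a)
  disjoint (_ , _ , refl) (_ , _ , ())

satisfiesAt? : ∀ {n} t (F : CNF n) (a : Assignment n) → Dec (a ⊨ F × weight a ≡ t)
satisfiesAt? t F a = a ⊨? F ×-dec weight a ≟ t

sat : ∀ {n} → ℕ → CNF n → List (Assignment n)
sat {n} t F = filter (satisfiesAt? t F) (assignments n)

∈-sat : ∀ {n} t (F : CNF n) {a} → a ∈ sat t F ⇔ (a ⊨ F × weight a ≡ t)
∈-sat {n} t F {a} = mk⇔
  (λ a∈ → proj₂ (∈-filter⁻ (satisfiesAt? t F) {xs = assignments n} a∈))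
  (∈-filter⁺ (satisfiesAt? t F) (∈-assignments a))

sat-unique : ∀ {n} t (F : CNF n) → Unique (sat t F)
sat-unique {n} t F = Unique.filter⁺ (satisfiesAt? t F) (assignments-unique n)

Admissible : ∀ {n} → ℕ → CNF n → Set
Admissible t F = ∀ a → a ⊨ F → ¬ (weight a < t)

admissible? : ∀ {n} t (F : CNF n) → Dec (Admissible t F)
admissible? t F = map′
  (λ ¬∃ a a⊨F a<t → ¬∃ (a , a⊨F , a<t))
  (λ adm (a , a⊨F , a<t) → adm a a⊨F a<t)
  (¬? (anySubset? (λ a → a ⊨? F ×-dec weight a <? t)))

-- A formula is equivalent to its set of clauses, so for the maximum it
-- suffices to range over the sublists of the finite list of all clauses of
-- width at most k; S-isMaximum shows that nothing is lost.

literals : ∀ n → List (Literal n)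
literals n = cartesianProduct (allFin n) (true ∷ false ∷ [])

clauses : ∀ n (k : ℕ) → List (Clause n)
clauses n zero    = [] ∷ []
clauses n (suc k) = [] ∷ cartesianProductWith _∷_ (literals n) (clauses n k)

sublists : ∀ {A : Set} → List A → List (List A)
sublists []       = [] ∷ []
sublists (x ∷ xs) = map (x ∷_) (sublists xs) ++ sublists xs

-- The default value 0 is attained by an unsatisfiable formula.
S : ℕ → ℕ → ℕ → ℕ
S n t k = max 0 (map (length ∘ sat t) (filter (admissible? t) (sublists (clauses n k))))

IsMaximum : (n t k m : ℕ) → Set
IsMaximum n t k m =
  (∃ λ (F : CNF n) → IsKCNF k F × Admissible t F × length (sat t F) ≡ m) ×
  (∀ (F : CNF n) → IsKCNF k F → Admissible t F → length (sat t F) ≤ m)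

module _ {n : ℕ} where

  private
    open DecMembership (≡-dec (Product.≡-dec (Fin._≟_ {n}) Bool._≟_)) using (_∈?_)

    ∈-literals : ∀ (l : Literal n) → l ∈ literals n
    ∈-literals (i , true)  = ∈-cartesianProduct⁺ (∈-allFin i) (here refl)
    ∈-literals (i , false) = ∈-cartesianProduct⁺ (∈-allFin i) (there (here refl))

    ∈-clauses⁺ : ∀ k (C : Clause n) → length C ≤ k → C ∈ clauses n k
    ∈-clauses⁺ zero    []      _       = here refl
    ∈-clauses⁺ (suc k) []      _       = here refl
    ∈-clauses⁺ (suc k) (l ∷ C) (s≤s p) =
      there (∈-cartesianProductWith⁺ _∷_ (∈-literals l) (∈-clauses⁺ k C p))

    ∈-clauses⁻ : ∀ k {C : Clause n} → C ∈ clauses n k → length C ≤ k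
    ∈-clauses⁻ zero    (here refl) = z≤n
    ∈-clauses⁻ (suc k) (here refl) = z≤n
    ∈-clauses⁻ (suc k) (there p)
      with _ , _ , _ , q , refl ← ∈-cartesianProductWith⁻ _∷_ (literals n) (clauses n k) p
      = s≤s (∈-clauses⁻ k q)

    filter∈sublists : ∀ (F : CNF n) Cs → filter (_∈? F) Cs ∈ sublists Cs
    filter∈sublists F [] = here refl
    filter∈sublists F (C ∷ Cs) with C ∈? F
    ... | yes _ = ∈-++⁺ˡ (∈-map⁺ _ (filter∈sublists F Cs))
    ... | no  _ = ∈-++⁺ʳ _ (filter∈sublists F Cs)

    sublists-all : ∀ {P : Clause n → Set} {Cs F} → All P Cs → F ∈ sublists Cs → All P F
    sublists-all [] (here refl) = []
    sublists-all {Cs = C ∷ Cs} (p ∷ ps) F∈ with ∈-++⁻ (map (C ∷_) (sublists Cs)) F∈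
    ... | inj₂ q = sublists-all ps q
    ... | inj₁ q with _ , r , refl ← ∈-map⁻ _ q = p ∷ sublists-all ps r

    normalise : ℕ → CNF n → CNF n
    normalise k F = filter (_∈? F) (clauses n k)

    ⊨-normalise⁺ : ∀ k F (a : Assignment n) → a ⊨ F → a ⊨ normalise k F
    ⊨-normalise⁺ k F a a⊨F =
      All.tabulate (λ C∈ → All.lookup a⊨F (proj₂ (∈-filter⁻ (_∈? F) {xs = clauses n k} C∈)))

    ⊨-normalise⁻ : ∀ k F (a : Assignment n) → IsKCNF k F → a ⊨ normalise k F → a ⊨ F
    ⊨-normalise⁻ k F a kF a⊨ = All.tabulate λ C∈F →
      All.lookup a⊨ (∈-filter⁺ (_∈? F) (∈-clauses⁺ k _ (All.lookup kF C∈F)) C∈F)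

    sat-normalise : ∀ t k F → IsKCNF k F → sat t F ≡ sat t (normalise k F)
    sat-normalise t k F kF = filter-≐ (satisfiesAt? t F) (satisfiesAt? t (normalise k F))
      ((λ {a} (p , q) → ⊨-normalise⁺ k F a p , q) , (λ {a} (p , q) → ⊨-normalise⁻ k F a kF p , q))
      (assignments n)

  S-isMaximum : ∀ t k → IsMaximum n t k (S n t k)
  S-isMaximum t k = attained (argmax-sel id 0 counts) , bound
    where
    formulas = filter (admissible? t) (sublists (clauses n k))
    counts   = map (length ∘ sat t) formulas

    attained : _ → ∃ λ (F : CNF n) → IsKCNF k F × Admissible t F × length (sat t F) ≡ S n t k
    attained (inj₁ S≡0) = ([] ∷ []) , z≤n ∷ [] , (λ { a (() ∷ _) }) ,
      trans (cong length (filter-none (satisfiesAt? t ([] ∷ [])) {xs = assignments n}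
        (All.universal (λ { a ((() ∷ _) , _) }) (assignments n)))) (sym S≡0)
    attained (inj₂ S∈)
      with F , F∈ , eq ← ∈-map⁻ _ S∈
      with F∈sub , adm ← ∈-filter⁻ (admissible? t) {xs = sublists (clauses n k)} F∈
      = F , sublists-all (All.tabulate (∈-clauses⁻ k)) F∈sub , adm , sym eq

    bound : ∀ F → IsKCNF k F → Admissible t F → length (sat t F) ≤ S n t k
    bound F kF adm = subst (_≤ S n t k) (sym (cong length (sat-normalise t k F kF)))
      (All.lookup (xs≤max 0 counts) (∈-map⁺ (length ∘ sat t)
        (∈-filter⁺ (admissible? t) (filter∈sublists F (clauses n k))
          (λ a → adm a ∘ ⊨-normalise⁻ k F a kF))))

fromℕ : ℕ → ℚ
fromℕ m = + m ℚ./ 1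

1-α≢0 : ∀ {α} → α ℚ.< 1ℚ → ℚ.NonZero (1ℚ ℚ.- α)
1-α≢0 {α} α<1 = ℚ.>-nonZero
  (subst (ℚ._< 1ℚ ℚ.- α) (ℚ.+-inverseʳ α) (ℚ.+-monoˡ-< (ℚ.- α) α<1))

{-# OPTIONS --safe #-}
-- Write b = c + (k - 1), so that c = α b. On one block of b variables take all
-- positive clauses of width k: they say that fewer than k variables are false,
-- i.e. that the weight is at least c, so this formula is c-admissible and all
-- binom(b, c) assignments of weight c satisfy it. Conjunctions over disjoint
-- sets of variables show that S is supermultiplicative, and n/b blocks give the
-- bound.
module Submission where

open import Defs
open import Algebra.Bundles using (CommutativeMonoid)
import Algebra.Properties.CommutativeSemigroup as CommutativeSemigroupProperties
import Algebra.Properties.Group as GroupProperties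
open import Data.Bool using (true; false)
open import Data.Empty using (⊥-elim)
open import Data.Fin using (Fin; zero; suc; _↑ˡ_; _↑ʳ_)
import Data.Fin.Properties as Fin
open import Data.Fin.Subset.Properties using (∣p∣≤n)
import Data.Integer as ℤ
import Data.Integer.Properties as ℤ
open import Data.List as List using (List; []; _∷_; _++_; length; map; filter; cartesianProductWith)
open import Data.List.Membership.Propositional.Properties using (∈-lookup; ∈-cartesianProductWith⁻)
open import Data.List.Membership.Setoid.Properties using (index-injective)
open import Data.List.Properties using (length-++; length-map; filter-++; filter-≐; filter-none)
open import Data.List.Relation.Binary.Subset.Propositional using (_⊆_)
open import Data.List.Relation.Unary.All as All using (All; []; _∷_)
import Data.List.Relation.Unary.All.Properties as All
open import Data.List.Relation.Unary.AllPairs using (_∷_)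
open import Data.List.Relation.Unary.Any as Any using (here; there)
import Data.List.Relation.Unary.Any.Properties as Any
open import Data.List.Relation.Unary.Unique.Propositional using (Unique)
import Data.List.Relation.Unary.Unique.Propositional.Properties as Unique
open import Data.Nat using (ℕ; zero; suc; _+_; _*_; _∸_; _≤_; _<_; _^_; _≟_; z≤n; s≤s; s≤s⁻¹; z<s)
open import Data.Nat.Combinatorics using (_C_; nCn≡1; nCk≡nC[n∸k]; k>n⇒nCk≡0; nCk+nC[k+1]≡[n+1]C[k+1])
open import Data.Nat.Coprimality using (1-coprimeTo) renaming (sym to coprime-sym)
open import Data.Nat.Divisibility using (_∣_; quotient; divides)
open import Data.Nat.Properties
open import Data.Product using (∃-syntax; _×_; _,_; map₁)
open import Data.Rational as ℚ using (ℚ; 0ℚ; 1ℚ)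
import Data.Rational.Properties as ℚ
open import Data.Rational.Solver using (module +-*-Solver)
import Data.Vec as Vec
open import Data.Vec using ([]; _∷_)
open import Data.Vec.Properties using (lookup-++ˡ; lookup-++ʳ; ++-injective)
open import Function using (_∘_; Equivalence)
open import Level using (Level)
open import Relation.Binary.PropositionalEquality
open import Relation.Nullary using (does)
open import Relation.Unary using (Pred; Decidable)

private module ℚ-+ = GroupProperties ℚ.+-0-group

private variable
  ℓ : Level
  A B : Set
  m n : ℕ

-- Lengths of lists.

lookup-injective : ∀ {xs : List A} → Unique xs →
  ∀ i j → List.lookup xs i ≡ List.lookup xs j → i ≡ j
lookup-injective (_ ∷ _)  zero    zero    _  = refl
lookup-injective (x∉ ∷ _) zero    (suc j) eq = ⊥-elim (All.lookup x∉ (∈-lookup j) eq)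
lookup-injective (x∉ ∷ _) (suc i) zero    eq = ⊥-elim (All.lookup x∉ (∈-lookup i) (sym eq))
lookup-injective (_ ∷ u)  (suc i) (suc j) eq = cong suc (lookup-injective u i j eq)

-- Sending a position of `xs` to the position where its entry is found in `ys` is injective: equal
-- images force equal entries, and uniqueness then forces equal positions.
unique⊆⇒length≤ : ∀ {xs ys : List A} → Unique xs → xs ⊆ ys → length xs ≤ length ys
unique⊆⇒length≤ u xs⊆ys = Fin.injective⇒≤ λ {i} {j} eq →
  lookup-injective u i j
    (index-injective (setoid _) (xs⊆ys (∈-lookup i)) (xs⊆ys (∈-lookup j)) eq)

length-filter-map : ∀ {P : Pred B ℓ} (P? : Decidable P) (f : A → B) xs →
  length (filter P? (map f xs)) ≡ length (filter (P? ∘ f) xs)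
length-filter-map P? f []       = refl
length-filter-map P? f (x ∷ xs) with does (P? (f x))
... | true  = cong suc (length-filter-map P? f xs)
... | false = length-filter-map P? f xs

length-cartesianProductWith : ∀ {C : Set} (f : A → B → C) xs ys →
  length (cartesianProductWith f xs ys) ≡ length xs * length ys
length-cartesianProductWith f []       ys = refl
length-cartesianProductWith f (x ∷ xs) ys = trans (length-++ (map (f x) ys))
  (cong₂ _+_ (length-map (f x) ys) (length-cartesianProductWith f xs ys))

-- Counting assignments by weight.

weight-++ : ∀ (a : Assignment m) (a′ : Assignment n) → weight (a Vec.++ a′) ≡ weight a + weight a′
weight-++ []          a′ = refl
weight-++ (true  ∷ a) a′ = cong suc (weight-++ a a′)
weight-++ (false ∷ a) a′ = weight-++ a a′

ofWeight : ∀ n → ℕ → List (Assignment n)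
ofWeight n c = filter (λ a → weight a ≟ c) (assignments n)

-- Splitting on the value of the first variable turns the count into Pascal's rule.
length-ofWeight : ∀ n c → length (ofWeight n c) ≡ n C c
length-ofWeight zero    zero    = refl
length-ofWeight zero    (suc c) = sym (k>n⇒nCk≡0 {k = suc c} z<s)
length-ofWeight (suc n) c = begin
  length (ofWeight (suc n) c)
    ≡⟨ cong length (filter-++ hasWeight? (map (true ∷_) (assignments n)) _) ⟩
  length (filter hasWeight? (map (true ∷_) (assignments n)) ++
          filter hasWeight? (map (false ∷_) (assignments n)))
    ≡⟨ length-++ (filter hasWeight? (map (true ∷_) (assignments n))) ⟩
  length (filter hasWeight? (map (true ∷_) (assignments n))) +
  length (filter hasWeight? (map (false ∷_) (assignments n)))
    ≡⟨ cong₂ _+_ (length-filter-map hasWeight? (true ∷_) (assignments n))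
                 (length-filter-map hasWeight? (false ∷_) (assignments n)) ⟩
  length (filter (λ a → suc (weight a) ≟ c) (assignments n)) + length (ofWeight n c)
    ≡⟨ pascal c ⟩
  suc n C c ∎
  where
  open ≡-Reasoning
  hasWeight? : Decidable (λ (a : Assignment (suc n)) → weight a ≡ c)
  hasWeight? a = weight a ≟ c

  pascal : ∀ c →
    length (filter (λ a → suc (weight a) ≟ c) (assignments n)) + length (ofWeight n c) ≡ suc n C c
  pascal zero = begin
    length (filter (λ a → suc (weight a) ≟ 0) (assignments n)) + length (ofWeight n 0)
      ≡⟨ cong₂ _+_ (cong length (filter-none (λ a → suc (weight a) ≟ 0)
                      (All.universal (λ _ ()) (assignments n))))
                   (length-ofWeight n 0) ⟩
    n C 0      ≡⟨ nCk≡nC[n∸k] {n = n} z≤n ⟩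
    n C n      ≡⟨ nCn≡1 n ⟩
    1          ≡⟨ nCn≡1 (suc n) ⟨
    suc n C suc n ≡⟨ nCk≡nC[n∸k] {n = suc n} z≤n ⟨
    suc n C 0  ∎
  pascal (suc c) = begin
    length (filter (λ a → suc (weight a) ≟ suc c) (assignments n)) + length (ofWeight n (suc c))
      ≡⟨ cong₂ _+_ (cong length (filter-≐ (λ a → suc (weight a) ≟ suc c) (λ a → weight a ≟ c)
                      (suc-injective , cong suc) (assignments n)))
                   (length-ofWeight n (suc c)) ⟩
    length (ofWeight n c) + n C suc c ≡⟨ cong (_+ n C suc c) (length-ofWeight n c) ⟩
    n C c + n C suc c                 ≡⟨ nCk+nC[k+1]≡[n+1]C[k+1] n c ⟩
    suc n C suc c                     ∎

-- Renaming variables.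

renameᶜ : (Fin m → Fin n) → Clause m → Clause n
renameᶜ f = map (map₁ f)

rename : (Fin m → Fin n) → CNF m → CNF n
rename f = map (renameᶜ f)

rename-kCNF : ∀ {k} (f : Fin m → Fin n) {F} → IsKCNF k F → IsKCNF k (rename f F)
rename-kCNF f = All.gmap⁺ λ {C} → subst (_≤ _) (sym (length-map (map₁ f) C))

-- The assumption makes `a′` the pullback of `a` along `f`. Stating it pointwise covers both uses:
-- the tail of an assignment and the two halves of a concatenation.
module _ {f : Fin m → Fin n} (a : Assignment n) (a′ : Assignment m)
         (a∘f≗a′ : ∀ i → Vec.lookup a (f i) ≡ Vec.lookup a′ i) where

  ⊨ᶜ-rename⁺ : ∀ {C} → a′ ⊨ᶜ C → a ⊨ᶜ renameᶜ f C
  ⊨ᶜ-rename⁺ = Any.map⁺ ∘ Any.map (trans (a∘f≗a′ _))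

  ⊨ᶜ-rename⁻ : ∀ {C} → a ⊨ᶜ renameᶜ f C → a′ ⊨ᶜ C
  ⊨ᶜ-rename⁻ = Any.map (trans (sym (a∘f≗a′ _))) ∘ Any.map⁻

  ⊨-rename⁺ : ∀ {F} → a′ ⊨ F → a ⊨ rename f F
  ⊨-rename⁺ = All.gmap⁺ ⊨ᶜ-rename⁺

  ⊨-rename⁻ : ∀ {F} → a ⊨ rename f F → a′ ⊨ F
  ⊨-rename⁻ = All.gmap⁻ ⊨ᶜ-rename⁻

-- Positive clauses of a fixed width.

positiveClauses : ∀ n → ℕ → CNF n
-- The empty set of variables gives the empty clause, so nothing satisfies the formula, just as no
-- assignment has fewer than 0 false variables.
positiveClauses n       zero    = [] ∷ []
positiveClauses zero    (suc k) = []
positiveClauses (suc n) (suc k) =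
  map ((zero , true) ∷_) (rename suc (positiveClauses n k)) ++
  rename suc (positiveClauses n (suc k))

positiveClauses-kCNF : ∀ n k → IsKCNF k (positiveClauses n k)
positiveClauses-kCNF n       zero    = z≤n ∷ []
positiveClauses-kCNF zero    (suc k) = []
positiveClauses-kCNF (suc n) (suc k) = All.++⁺
  (All.gmap⁺ s≤s (rename-kCNF suc (positiveClauses-kCNF n k)))
  (rename-kCNF suc (positiveClauses-kCNF n (suc k)))

-- Any `k` false variables would form a falsified clause, so there are fewer than `k` of them; the
-- additive form avoids truncated subtraction. In the induction a true first variable leaves width
-- `suc k` for the tail, while a false one drops out of its clauses and leaves width `k`.
⊨-positiveClauses⁻ : ∀ k (a : Assignment n) → a ⊨ positiveClauses n k → n < weight a + k
⊨-positiveClauses⁻ zero    a  (() ∷ _)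
⊨-positiveClauses⁻ (suc k) [] _ = z<s
⊨-positiveClauses⁻ {suc n} (suc k) (true ∷ a) a⊨ =
  s≤s (⊨-positiveClauses⁻ (suc k) a
    (⊨-rename⁻ (true ∷ a) a (λ _ → refl) (All.++⁻ʳ (map _ (rename suc (positiveClauses n k))) a⊨)))
⊨-positiveClauses⁻ {suc n} (suc k) (false ∷ a) a⊨ =
  subst (suc n <_) (sym (+-suc (weight a) k)) (s≤s (⊨-positiveClauses⁻ k a
    (⊨-rename⁻ (false ∷ a) a (λ _ → refl)
      -- The literal on variable zero is false here, so the rest of the clause must hold.
      (All.gmap⁻ (λ { (there p) → p })
        (All.++⁻ˡ (map _ (rename suc (positiveClauses n k))) a⊨)))))

⊨-positiveClauses⁺ : ∀ k (a : Assignment n) → n < weight a + k → a ⊨ positiveClauses n k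
⊨-positiveClauses⁺ zero a n< =
  -- Width 0 would require a weight above `n`.
  ⊥-elim (<⇒≱ n< (subst (_≤ _) (sym (+-identityʳ (weight a))) (∣p∣≤n a)))
⊨-positiveClauses⁺ (suc k) [] _ = []
⊨-positiveClauses⁺ {suc n} (suc k) (true ∷ a) n< = All.++⁺
  (All.map⁺ (All.universal (λ _ → here refl) (rename suc (positiveClauses n k))))
  (⊨-rename⁺ (true ∷ a) a (λ _ → refl) (⊨-positiveClauses⁺ (suc k) a (s≤s⁻¹ n<)))
⊨-positiveClauses⁺ {suc n} (suc k) (false ∷ a) n< = All.++⁺
  (All.gmap⁺ there (⊨-rename⁺ (false ∷ a) a (λ _ → refl)
    (⊨-positiveClauses⁺ k a (s≤s⁻¹ (subst (suc n <_) (+-suc (weight a) k) n<)))))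
  -- The clauses avoiding variable zero still have width `suc k`, so the bound holds with one to
  -- spare.
  (⊨-rename⁺ (false ∷ a) a (λ _ → refl) (⊨-positiveClauses⁺ (suc k) a (<-trans (n<1+n n) n<)))

-- Lower bounds for `S`.

length-sat≤S : ∀ {k t} {F : CNF n} → IsKCNF k F → Admissible t F → length (sat t F) ≤ S n t k
length-sat≤S {k = k} {t} kF adm with _ , bound ← S-isMaximum t k = bound _ kF adm

-- For width `suc j` the criterion `c + j < w + suc j` reads `c ≤ w`: the positive clauses exclude
-- exactly the weights below `c`.
binomial≤S : ∀ c j → (c + j) C c ≤ S (c + j) c (suc j)
binomial≤S c j = begin
  b C c                 ≡⟨ length-ofWeight b c ⟨
  length (ofWeight b c) ≡⟨ cong length (filter-≐ (λ a → weight a ≟ c) (satisfiesAt? c F)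
                             ((λ {a} w≡c → satisfies a w≡c , w≡c) , λ (_ , w≡c) → w≡c)
                             (assignments b)) ⟩
  length (sat c F)      ≤⟨ length-sat≤S (positiveClauses-kCNF b (suc j)) admissible ⟩
  S b c (suc j)         ∎
  where
  open ≤-Reasoning
  b = c + j
  F = positiveClauses b (suc j)

  satisfies : ∀ a → weight a ≡ c → a ⊨ F
  satisfies a w≡c = ⊨-positiveClauses⁺ (suc j) a
    (subst (λ w → b < w + suc j) (sym w≡c) (≤-reflexive (sym (+-suc c j))))

  admissible : Admissible c F
  admissible a a⊨F w<c = <⇒≱ w<c (+-cancelʳ-≤ j c (weight a)
    (s≤s⁻¹ (subst (b <_) (+-suc (weight a) j) (⊨-positiveClauses⁻ (suc j) a a⊨F))))

-- Formulas attaining the two maxima are placed on disjoint variables; concatenating their solutions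
-- gives distinct solutions of the conjunction.
S-supermultiplicative : ∀ m n s t k → S m s k * S n t k ≤ S (m + n) (s + t) k
S-supermultiplicative m n s t k
  with (F , kF , admF , satF) , _ ← S-isMaximum {m} s k
  with (G , kG , admG , satG) , _ ← S-isMaximum {n} t k = begin
  S m s k * S n t k                   ≡⟨ cong₂ _*_ satF satG ⟨
  length (sat s F) * length (sat t G) ≡⟨ length-cartesianProductWith Vec._++_ (sat s F) (sat t G) ⟨
  length concatenations               ≤⟨ unique⊆⇒length≤ concatenations-unique concatenations⊆ ⟩
  length (sat (s + t) H)              ≤⟨ length-sat≤S kH admH ⟩
  S (m + n) (s + t) k                 ∎
  where
  open ≤-Reasoning
  H : CNF (m + n)
  H = rename (_↑ˡ n) F ++ rename (m ↑ʳ_) G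

  kH : IsKCNF k H
  kH = All.++⁺ (rename-kCNF (_↑ˡ n) kF) (rename-kCNF (m ↑ʳ_) kG)

  admH : Admissible (s + t) H
  -- Each half satisfies its own formula, so admissibility bounds its weight from below, and the
  -- weights add up.
  admH a a⊨H w< with a₁ , a₂ , refl ← Vec.splitAt m a
                with a⊨F , a⊨G ← All.++⁻ (rename (_↑ˡ n) F) a⊨H =
    <⇒≱ w< (subst (s + t ≤_) (sym (weight-++ a₁ a₂)) (+-mono-≤
      (≮⇒≥ (admF a₁ (⊨-rename⁻ (a₁ Vec.++ a₂) a₁ (lookup-++ˡ a₁ a₂) a⊨F)))
      (≮⇒≥ (admG a₂ (⊨-rename⁻ (a₁ Vec.++ a₂) a₂ (lookup-++ʳ a₁ a₂) a⊨G)))))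

  concatenations : List (Assignment (m + n))
  concatenations = cartesianProductWith Vec._++_ (sat s F) (sat t G)

  concatenations-unique : Unique concatenations
  concatenations-unique = Unique.cartesianProductWith⁺ Vec._++_ (++-injective _ _)
    (sat-unique s F) (sat-unique t G)

  concatenations⊆ : concatenations ⊆ sat (s + t) H
  concatenations⊆ a∈
    with a₁ , a₂ , a₁∈ , a₂∈ , refl ← ∈-cartesianProductWith⁻ Vec._++_ (sat s F) (sat t G) a∈
    with a₁⊨F , w₁ ← Equivalence.to (∈-sat s F) a₁∈
    with a₂⊨G , w₂ ← Equivalence.to (∈-sat t G) a₂∈ =
    Equivalence.from (∈-sat (s + t) H)
      ( All.++⁺ (⊨-rename⁺ (a₁ Vec.++ a₂) a₁ (lookup-++ˡ a₁ a₂) a₁⊨F)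
                (⊨-rename⁺ (a₁ Vec.++ a₂) a₂ (lookup-++ʳ a₁ a₂) a₂⊨G)
      , trans (weight-++ a₁ a₂) (cong₂ _+_ w₁ w₂))

S-power : ∀ b c k q → S b c k ^ q ≤ S (q * b) (q * c) k
-- On no variables the empty formula has one solution, the empty assignment, which matches the empty
-- product 1.
S-power b c k zero    = length-sat≤S {n = 0} {k} {0} {[]} [] (λ _ _ ())
S-power b c k (suc q) = ≤-trans (*-monoʳ-≤ (S b c k) (S-power b c k q))
  (S-supermultiplicative b (q * b) c (q * c) k)

-- Integrality of α b and α n.

fromℕ≡mkℚ : ∀ m → fromℕ m ≡ ℚ.mkℚ (ℤ.+ m) 0 (coprime-sym (1-coprimeTo m))
fromℕ≡mkℚ m = ℚ.normalize-coprime (coprime-sym (1-coprimeTo m))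

fromℕ-+ : ∀ m n → fromℕ (m + n) ≡ fromℕ m ℚ.+ fromℕ n
-- `fromℕ` normalises by a gcd that is stuck on a variable; the explicit fractions let the sum
-- reduce.
fromℕ-+ m n rewrite fromℕ≡mkℚ m | fromℕ≡mkℚ n = ℚ./-cong
  (cong₂ ℤ._+_ (sym (ℤ.*-identityʳ (ℤ.+ m))) (sym (ℤ.*-identityʳ (ℤ.+ n)))) refl

fromℕ-* : ∀ m n → fromℕ (m * n) ≡ fromℕ m ℚ.* fromℕ n
fromℕ-* m n rewrite fromℕ≡mkℚ m | fromℕ≡mkℚ n = ℚ./-cong (ℤ.pos-* m n) refl

fromℕ-cancel-≤ : ∀ m n → fromℕ m ℚ.≤ fromℕ n → m ≤ n
fromℕ-cancel-≤ m n m≤n rewrite fromℕ≡mkℚ m | fromℕ≡mkℚ n = ℤ.drop‿+≤+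
  (subst₂ ℤ._≤_ (ℤ.*-identityʳ (ℤ.+ m)) (ℤ.*-identityʳ (ℤ.+ n)) (ℚ.drop-*≤* m≤n))

-- Here `j` is k - 1, and both sides are multiplied by 1 - α.
clear-denominator : ∀ j α b .{{_ : ℚ.NonZero (1ℚ ℚ.- α)}} →
  fromℕ b ≡ (fromℕ (suc j) ℚ.- 1ℚ) ℚ.÷ (1ℚ ℚ.- α) → α ℚ.* fromℕ b ℚ.+ fromℕ j ≡ fromℕ b
clear-denominator j α b b≡ = identity α (fromℕ b) (fromℕ j) (ℚ.1/ (1ℚ ℚ.- α))
  (ℚ.*-inverseˡ (1ℚ ℚ.- α))
  (trans b≡ (cong (λ x → (x ℚ.- 1ℚ) ℚ.÷ (1ℚ ℚ.- α)) (fromℕ-+ 1 j)))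
  where
  open ≡-Reasoning
  open +-*-Solver

  -- The inverse becomes a variable `r` known only by its defining equation, so that the ring solver
  -- applies.
  identity : ∀ α b j r → r ℚ.* (1ℚ ℚ.- α) ≡ 1ℚ →
    b ≡ ((1ℚ ℚ.+ j) ℚ.- 1ℚ) ℚ.* r → α ℚ.* b ℚ.+ j ≡ b
  identity α b j r r[1-α]≡1 b≡ = begin
    α ℚ.* b ℚ.+ j                            ≡⟨ cong (α ℚ.* b ℚ.+_) (ℚ.*-identityʳ j) ⟨
    α ℚ.* b ℚ.+ j ℚ.* 1ℚ                     ≡⟨ cong (λ x → α ℚ.* b ℚ.+ j ℚ.* x) r[1-α]≡1 ⟨
    α ℚ.* b ℚ.+ j ℚ.* (r ℚ.* (1ℚ ℚ.- α))
      ≡⟨ solve 4 (λ α b j r →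
           α :* b :+ j :* (r :* (con 1ℚ :- α)) :=
           α :* b :+ ((con 1ℚ :+ j) :- con 1ℚ) :* r :* (con 1ℚ :- α)) refl α b j r ⟩
    α ℚ.* b ℚ.+ ((1ℚ ℚ.+ j) ℚ.- 1ℚ) ℚ.* r ℚ.* (1ℚ ℚ.- α)
      ≡⟨ cong (λ x → α ℚ.* b ℚ.+ x ℚ.* (1ℚ ℚ.- α)) b≡ ⟨
    α ℚ.* b ℚ.+ b ℚ.* (1ℚ ℚ.- α)             ≡⟨ solve 2 (λ α b → α :* b :+ b :* (con 1ℚ :- α) := b) refl α b ⟩
    b                                        ∎

αb-integral⇒αqb-integral : ∀ q c α b → fromℕ c ≡ α ℚ.* fromℕ b → fromℕ (q * c) ≡ α ℚ.* fromℕ (q * b)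
αb-integral⇒αqb-integral q c α b c≡ = begin
  fromℕ (q * c)                 ≡⟨ fromℕ-* q c ⟩
  fromℕ q ℚ.* fromℕ c           ≡⟨ cong (fromℕ q ℚ.*_) c≡ ⟩
  fromℕ q ℚ.* (α ℚ.* fromℕ b)   ≡⟨ x∙yz≈y∙xz (fromℕ q) α (fromℕ b) ⟩
  α ℚ.* (fromℕ q ℚ.* fromℕ b)   ≡⟨ cong (α ℚ.*_) (fromℕ-* q b) ⟨
  α ℚ.* fromℕ (q * b)           ∎
  where
  open ≡-Reasoning
  open CommutativeSemigroupProperties
    (CommutativeMonoid.commutativeSemigroup ℚ.*-1-commutativeMonoid) using (x∙yz≈y∙xz)

-- The equation makes α b equal to b - j. As α b is nonnegative, `j ≤ b`, so the truncated
-- difference is the true one.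
αb-integral : ∀ α b j → 0ℚ ℚ.≤ α → α ℚ.* fromℕ b ℚ.+ fromℕ j ≡ fromℕ b →
  ∃[ c ] c + j ≡ b × fromℕ c ≡ α ℚ.* fromℕ b
αb-integral α b j 0≤α eq = b ∸ j , c+j≡b , c≡αb
  where
  instance
    _ = ℚ.nonNegative 0≤α
    _ = ℚ.normalize-nonNeg b 1

  0≤αb : 0ℚ ℚ.≤ α ℚ.* fromℕ b
  0≤αb = ℚ.nonNegative⁻¹ _ {{ℚ.nonNeg*nonNeg⇒nonNeg α (fromℕ b)}}

  c+j≡b : b ∸ j + j ≡ b
  c+j≡b = m∸n+n≡m (fromℕ-cancel-≤ j b
    (subst₂ ℚ._≤_ (ℚ.+-identityˡ (fromℕ j)) eq (ℚ.+-monoˡ-≤ (fromℕ j) 0≤αb)))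

  c≡αb : fromℕ (b ∸ j) ≡ α ℚ.* fromℕ b
  c≡αb = ℚ-+.∙-cancelʳ (fromℕ j) _ _
    (trans (sym (fromℕ-+ (b ∸ j) j)) (trans (cong fromℕ c+j≡b) (sym eq)))

-- With `c` and `b` independent variables, the equation can be matched with `refl`.
C^≤S : ∀ c j q {b} → c + j ≡ b → (b C c) ^ q ≤ S (q * b) (q * c) (suc j)
C^≤S c j q refl = ≤-trans (^-monoˡ-≤ q (binomial≤S c j)) (S-power (c + j) c (suc j) q)

theorem2 : ∀ (k : ℕ) → 2 ≤ k →
    ∀ (α : ℚ) → 0ℚ ℚ.≤ α → (α<1 : α ℚ.< 1ℚ) →
    ∀ (b : ℕ) → fromℕ b ≡ ((fromℕ k ℚ.- 1ℚ) ℚ.÷ (1ℚ ℚ.- α)) {{1-α≢0 α<1}} →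
    ∀ (n : ℕ) → 0 < n → (b∣n : b ∣ n) →
    ∃[ t ] ∃[ c ]
    fromℕ t ≡ α ℚ.* fromℕ n ×
    fromℕ c ≡ α ℚ.* fromℕ b ×
    (b C c) ^ quotient b∣n ≤ S n t k
theorem2 (suc j) _ α 0≤α α<1 b b≡ _ _ (divides q refl) =
  -- Now k is `suc j` and n is `q * b`; each of the `q` blocks contributes weight `c`, so t is
  -- `q * c`.
  let c , c+j≡b , c≡ = αb-integral α b j 0≤α (clear-denominator j α b {{1-α≢0 α<1}} b≡)
  in q * c , c , αb-integral⇒αqb-integral q c α b c≡ , c≡ , C^≤S c j q c+j≡b
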